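{- Work in intuitionistic (axiom-free) second-order arithmetic, without Markov's principle, with models ranging over structures representable there. Let $\mathcal{L}$ be a signature with countably many function and predicate symbols, let $\mathcal{T}_0$ be a recursively enumerable set of formulae over $\mathcal{L}$ (i.e. membership is given by a $\Sigma^0_1$ formula via a coding of formulae), and let $A_0$ be a formula. If $\mathcal{T}_0\vDash^e A_0$, then $\mathcal{T}_0\vdash A_0$.
   Context: Formulae over $\mathcal{L}$ are built from atoms $P(t_1,\dots,t_{a_P})$, $\dot{\bot}$, $A\,\dot{\Rightarrow}\,B$ and $\dot{\forall}x\,A$ (terms built from a countable set of variables and function symbols); $\dot{\neg}A$ abbreviates $A\,\dot{\Rightarrow}\,\dot{\bot}$. $\Gamma\vdash A$ denotes provability in a standard system for classical first-order logic (e.g. natural deduction with rules for $\dot{\Rightarrow}$, $\dot{\forall}$ and double-negation elimination); $\mathcal{T}\vdash A$ means $\Gamma\vdash A$ for some finite list $\Gamma$ of elements of $\mathcal{T}$. A possibly-exploding model $\mathcal{M}=(\mathcal{D},\mathcal{F},\mathcal{P},\mathcal{A}_{\dot{\bot}})$ consists of a domain $\mathcal{D}$, functions $\mathcal{F}(f):\mathcal{D}^{a_f}\to\mathcal{D}$, predicates $\mathcal{P}(P)\subseteq\mathcal{D}^{a_P}$, and a metalanguage proposition $\mathcal{A}_{\dot{\bot}}$. For an assignment $\sigma$ of variables in $\mathcal{D}$, truth $\mathcal{M}\vDash^e_\sigma A$ is defined recursively: atoms true iff the tuple of term values is in $\mathcal{P}(P)$; $\dot{\bot}$ is interpreted as $\mathcal{A}_{\dot{\bot}}$;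 $\dot{\Rightarrow}$ as metalanguage implication; $\dot{\forall}x\,A$ as $\forall v\in\mathcal{D}$, truth of $A$ under $\sigma[x\leftarrow v]$. $\mathcal{C}\mathit{lassic}=\{\dot{\neg}\dot{\neg}A\,\dot{\Rightarrow}\,A\mid A\text{ a formula}\}$. $\mathcal{T}\vDash^e A$ means: for every possibly-exploding model $\mathcal{M}$ and every assignment $\sigma$, if every formula of $\mathcal{C}\mathit{lassic}$ and every formula of $\mathcal{T}$ is true in $\mathcal{M}$ under $\sigma$, then $A$ is true in $\mathcal{M}$ under $\sigma$. -}

module Defs where

open import Data.Nat using (ℕ; zero; suc)
open import Data.Vec using (Vec; []; _∷_)
open import Data.List using (List; []; _∷_; map)
open import Data.List.Membership.Propositional using (_∈_)
open import Data.List.Relation.Unary.All using (All)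
open import Data.Maybe using (Maybe; just)
open import Data.Product using (Σ; ∃; _×_)
open import Relation.Binary.PropositionalEquality using (_≡_)
open import Function.Bundles using (_⇔_)

record Signature : Set where
  field
    funAr  : ℕ → ℕ
    predAr : ℕ → ℕ

module Syntax (S : Signature) where
  open Signature S

  data Term : Set where
    var : ℕ → Term
    fun : (f : ℕ) → Vec Term (funAr f) → Term

  -- Formulae: atoms, ⊥̇, ⇒̇, ∀̇ (binding de Bruijn index 0).
  data Form : Set where
    atom : (P : ℕ) → Vec Term (predAr P) → Form
    ⊥̇    : Form
    _⇒̇_  : Form → Form → Form
    ∀̇    : Form → Form

  infixr 5 _⇒̇_

  ¬̇_ : Form → Form
  ¬̇ A = A ⇒̇ ⊥̇

  mutual
    substT : (ℕ → Term) → Term → Term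
    substT σ (var n)    = σ n
    substT σ (fun f ts) = fun f (substTs σ ts)

    substTs : ∀ {n} → (ℕ → Term) → Vec Term n → Vec Term n
    substTs σ []       = []
    substTs σ (t ∷ ts) = substT σ t ∷ substTs σ ts

  shiftT : Term → Term
  shiftT = substT (λ n → var (suc n))

  up : (ℕ → Term) → ℕ → Term
  up σ zero    = var zero
  up σ (suc n) = shiftT (σ n)

  substF : (ℕ → Term) → Form → Form
  substF σ (atom P ts) = atom P (substTs σ ts)
  substF σ ⊥̇          = ⊥̇
  substF σ (A ⇒̇ B)     = substF σ A ⇒̇ substF σ B
  substF σ (∀̇ A)       = ∀̇ (substF (up σ) A)

  inst : Term → ℕ → Term
  inst t zero    = t
  inst t (suc n) = var n

  _[_] : Form → Term → Form
  A [ t ] = substF (inst t) A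

  shiftF : Form → Form
  shiftF = substF (λ n → var (suc n))

  infix 3 _⊢_
  data _⊢_ : List Form → Form → Set where
    ctx  : ∀ {Γ A} → A ∈ Γ → Γ ⊢ A
    ⇒I   : ∀ {Γ A B} → (A ∷ Γ) ⊢ B → Γ ⊢ A ⇒̇ B
    ⇒E   : ∀ {Γ A B} → Γ ⊢ A ⇒̇ B → Γ ⊢ A → Γ ⊢ B
    ∀I   : ∀ {Γ A} → map shiftF Γ ⊢ A → Γ ⊢ ∀̇ A
    ∀E   : ∀ {Γ A} → Γ ⊢ ∀̇ A → (t : Term) → Γ ⊢ A [ t ]
    ⊥E   : ∀ {Γ A} → Γ ⊢ ⊥̇ → Γ ⊢ A
    DNE  : ∀ {Γ A} → Γ ⊢ ¬̇ (¬̇ A) → Γ ⊢ A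

  _⊢T_ : (Form → Set) → Form → Set
  T ⊢T A = Σ (List Form) (λ Γ → All T Γ × (Γ ⊢ A))

  -- Possibly-exploding models
  record Model : Set₁ where
    field
      D     : Set
      funI  : (f : ℕ) → Vec D (funAr f) → D
      predI : (P : ℕ) → Vec D (predAr P) → Set
      A⊥    : Set

  module _ (M : Model) where
    open Model M

    _∷ₐ_ : D → (ℕ → D) → ℕ → D
    (d ∷ₐ σ) zero    = d
    (d ∷ₐ σ) (suc n) = σ n

    mutual
      evalT : (ℕ → D) → Term → D
      evalT σ (var n)    = σ n
      evalT σ (fun f ts) = funI f (evalTs σ ts)

      evalTs : ∀ {n} → (ℕ → D) → Vec Term n → Vec D n
      evalTs σ []       = []
      evalTs σ (t ∷ ts) = evalT σ t ∷ evalTs σ ts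

    sat : (ℕ → D) → Form → Set
    sat σ (atom P ts) = predI P (evalTs σ ts)
    sat σ ⊥̇          = A⊥
    sat σ (A ⇒̇ B)     = sat σ A → sat σ B
    sat σ (∀̇ A)       = (d : D) → sat (d ∷ₐ σ) A

  _⊨ᵉ_ : (Form → Set) → Form → Set₁
  T ⊨ᵉ A = (M : Model) (σ : ℕ → Model.D M)
         → ((B : Form) → sat M σ (¬̇ (¬̇ B) ⇒̇ B))
         → ((B : Form) → T B → sat M σ B)
         → sat M σ A

  -- 𝒯 is recursively enumerable: membership is Σ⁰₁, given by an
  -- (Agda-definable, hence computable) enumeration.
  Enumerable : (Form → Set) → Set
  Enumerable T = Σ (ℕ → Maybe Form) (λ e → (A : Form) → T A ⇔ ∃ (λ n → e n ≡ just A))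

-- Let U = T ∪ {¬A}, moved onto the even variables. Build stages: stage n+1 adds the
-- Henkin axiom C[x] ⇒ ∀C for the formula C coded n, with x = 2n+1 fresh, and admits the
-- formula B coded n on the sole condition that refuting B from the stage so far would
-- refute U. Neither addition can make ⊥ derivable unless U ⊢ ⊥, so no consistency test
-- (which would need excluded middle) is ever performed. In the union Uω a formula is
-- derivable as soon as its negation refutes Uω; this is exactly what makes the term model,
-- with ⊥ read as "Uω ⊢ ⊥", satisfy B iff Uω ⊢ B. That model satisfies T, the classical
-- axioms and ¬A, so if it satisfies A then U ⊢ ⊥, i.e. T ⊢ A.

module Submission where

open import Defs
open import Data.Nat using (ℕ; zero; suc; _+_; _*_; _⊔_; _≤_; _<_; _≤′_; ≤′-refl; ≤′-step; _≟_; ⌊_/2⌋; s≤s)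
open import Data.Nat.Properties
open import Data.Vec using (Vec; []; _∷_)
open import Data.List using (List; []; _∷_; map; _++_)
open import Data.List.Properties using (map-∘; map-cong; map-cong-local)
open import Data.List.Membership.Propositional.Properties using (∈-map⁺)
open import Data.List.Relation.Binary.Subset.Propositional using (_⊆_)
import Data.List.Relation.Binary.Subset.Propositional.Properties as ⊆
open import Data.List.Relation.Unary.All as All using (All; []; _∷_)
import Data.List.Relation.Unary.All.Properties as All
open import Data.List.Relation.Unary.Any using (here; there)
open import Data.Product using (∃; _×_; _,_; proj₁; proj₂)
open import Data.Sum using (_⊎_; inj₁; inj₂)
open import Data.Unit using (⊤; tt)
open import Function using (_∘_)
open import Relation.Nullary using (yes; no; contradiction)
open import Relation.Binary.PropositionalEquality hiding ([_])
open import Relation.Binary.Definitions using (tri<; tri≈; tri>)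

-- Cantor pairing

triangle : ℕ → ℕ
triangle zero    = zero
triangle (suc s) = suc s + triangle s

n≤triangle[n] : ∀ n → n ≤ triangle n
n≤triangle[n] zero    = ≤-refl
n≤triangle[n] (suc n) = m≤m+n (suc n) (triangle n)

triangle-gap : ∀ {a s s′} → a ≤ s → s < s′ → triangle s + a < triangle s′
triangle-gap {a} {s} {suc s′} a≤s (s≤s s≤s′) with m≤n⇒m<n∨m≡n s≤s′
... | inj₁ s<s′ = ≤-trans (triangle-gap a≤s s<s′) (m≤n+m (triangle s′) (suc s′))
... | inj₂ refl = s≤s (≤-trans (+-monoʳ-≤ (triangle s) a≤s) (≤-reflexive (+-comm (triangle s) s)))

-- Kept abstract so that unification can read a, b off an equation pair a b ≡ pair c d.
abstract
  pair : ℕ → ℕ → ℕ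
  pair a b = triangle (a + b) + a

  pair-< : ∀ a b c d → a + b < c + d → pair a b < pair c d
  pair-< a b c d lt = ≤-trans (triangle-gap (m≤m+n a b) lt) (m≤m+n (triangle (c + d)) c)

  pair-injective : ∀ {a b c d} → pair a b ≡ pair c d → a ≡ c × b ≡ d
  pair-injective {a} {b} {c} {d} eq with <-cmp (a + b) (c + d)
  ... | tri< lt _ _ = contradiction eq (<⇒≢ (pair-< a b c d lt))
  ... | tri> _ _ gt = contradiction (sym eq) (<⇒≢ (pair-< c d a b gt))
  ... | tri≈ _ a+b≡c+d _ = a≡c , +-cancelˡ-≡ a b d (trans a+b≡c+d (cong (_+ d) (sym a≡c)))
    where
      a≡c : a ≡ c
      a≡c = +-cancelˡ-≡ (triangle (a + b)) a c (trans eq (cong (λ s → triangle s + c) (sym a+b≡c+d)))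

  ≤-pairˡ : ∀ a b → a ≤ pair a b
  ≤-pairˡ a b = m≤n+m a (triangle (a + b))

  ≤-pairʳ : ∀ a b → b ≤ pair a b
  ≤-pairʳ a b = ≤-trans (m≤n+m b a) (≤-trans (n≤triangle[n] (a + b)) (m≤m+n (triangle (a + b)) a))

module Completeness (S : Signature) where
  open Syntax S

  Subst : Set
  Subst = ℕ → Term

  Theory : Set₁
  Theory = Form → Set

  variable
    k m n : ℕ
    P Q : ℕ → Set
    σ τ : Subst
    A B C : Form
    Γ Δ : List Form
    X Y : Theory

  -- Free variables and substitution

  liftP : (ℕ → Set) → ℕ → Set
  liftP P zero    = ⊤
  liftP P (suc n) = P n

  mutual
    AllVarT : (ℕ → Set) → Term → Set
    AllVarT P (var n)    = P n
    AllVarT P (fun f ts) = AllVarTs P ts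

    AllVarTs : (ℕ → Set) → Vec Term k → Set
    AllVarTs P []       = ⊤
    AllVarTs P (t ∷ ts) = AllVarT P t × AllVarTs P ts

  AllVarF : (ℕ → Set) → Form → Set
  AllVarF P (atom R ts) = AllVarTs P ts
  AllVarF P ⊥̇           = ⊤
  AllVarF P (A ⇒̇ B)     = AllVarF P A × AllVarF P B
  AllVarF P (∀̇ A)       = AllVarF (liftP P) A

  liftP-mono : (∀ m → P m → Q m) → ∀ m → liftP P m → liftP Q m
  liftP-mono P⊆Q zero    _ = tt
  liftP-mono P⊆Q (suc m) p = P⊆Q m p

  mutual
    AllVarT-mono : (∀ m → P m → Q m) → ∀ t → AllVarT P t → AllVarT Q t
    AllVarT-mono P⊆Q (var n)    p = P⊆Q n p
    AllVarT-mono P⊆Q (fun f ts) p = AllVarTs-mono P⊆Q ts p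

    AllVarTs-mono : (∀ m → P m → Q m) → (ts : Vec Term k) → AllVarTs P ts → AllVarTs Q ts
    AllVarTs-mono P⊆Q []       _       = tt
    AllVarTs-mono P⊆Q (t ∷ ts) (p , q) = AllVarT-mono P⊆Q t p , AllVarTs-mono P⊆Q ts q

  AllVarF-mono : (∀ m → P m → Q m) → ∀ A → AllVarF P A → AllVarF Q A
  AllVarF-mono P⊆Q (atom R ts) p       = AllVarTs-mono P⊆Q ts p
  AllVarF-mono P⊆Q ⊥̇           _       = tt
  AllVarF-mono P⊆Q (A ⇒̇ B)     (p , q) = AllVarF-mono P⊆Q A p , AllVarF-mono P⊆Q B q
  AllVarF-mono P⊆Q (∀̇ A)       p       = AllVarF-mono (liftP-mono P⊆Q) A p

  mutual
    AllVarT-universal : (∀ m → P m) → ∀ t → AllVarT P t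
    AllVarT-universal all (var n)    = all n
    AllVarT-universal all (fun f ts) = AllVarTs-universal all ts

    AllVarTs-universal : (∀ m → P m) → (ts : Vec Term k) → AllVarTs P ts
    AllVarTs-universal all []       = tt
    AllVarTs-universal all (t ∷ ts) = AllVarT-universal all t , AllVarTs-universal all ts

  AllVarF-universal : (∀ m → P m) → ∀ A → AllVarF P A
  AllVarF-universal all (atom R ts) = AllVarTs-universal all ts
  AllVarF-universal all ⊥̇           = tt
  AllVarF-universal all (A ⇒̇ B)     = AllVarF-universal all A , AllVarF-universal all B
  AllVarF-universal all (∀̇ A)       = AllVarF-universal (λ { zero → tt ; (suc m) → all m }) A

  mutual
    AllVarT-substT : ∀ σ → (∀ m → P m → AllVarT Q (σ m)) → ∀ t → AllVarT P t → AllVarT Q (substT σ t)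
    AllVarT-substT σ h (var n)    p = h n p
    AllVarT-substT σ h (fun f ts) p = AllVarTs-substTs σ h ts p

    AllVarTs-substTs : ∀ σ → (∀ m → P m → AllVarT Q (σ m)) → (ts : Vec Term k) → AllVarTs P ts → AllVarTs Q (substTs σ ts)
    AllVarTs-substTs σ h []       _       = tt
    AllVarTs-substTs σ h (t ∷ ts) (p , q) = AllVarT-substT σ h t p , AllVarTs-substTs σ h ts q

  AllVarF-substF : ∀ σ → (∀ m → P m → AllVarT Q (σ m)) → ∀ A → AllVarF P A → AllVarF Q (substF σ A)
  AllVarF-substF σ h (atom R ts) p       = AllVarTs-substTs σ h ts p
  AllVarF-substF σ h ⊥̇           _       = tt
  AllVarF-substF σ h (A ⇒̇ B)     (p , q) = AllVarF-substF σ h A p , AllVarF-substF σ h B q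
  AllVarF-substF {P} {Q} σ h (∀̇ A) p     = AllVarF-substF (up σ) h↑ A p
    where
      h↑ : ∀ m → liftP P m → AllVarT (liftP Q) (up σ m)
      h↑ zero    _ = tt
      h↑ (suc m) q = AllVarT-substT (λ n → var (suc n)) (λ n r → r) (σ m) (h m q)

  mutual
    substT-agree : (∀ m → P m → σ m ≡ τ m) → ∀ t → AllVarT P t → substT σ t ≡ substT τ t
    substT-agree σ≈τ (var n)    p = σ≈τ n p
    substT-agree σ≈τ (fun f ts) p = cong (fun f) (substTs-agree σ≈τ ts p)

    substTs-agree : (∀ m → P m → σ m ≡ τ m) → (ts : Vec Term k) → AllVarTs P ts → substTs σ ts ≡ substTs τ ts
    substTs-agree σ≈τ []       _       = refl
    substTs-agree σ≈τ (t ∷ ts) (p , q) = cong₂ _∷_ (substT-agree σ≈τ t p) (substTs-agree σ≈τ ts q)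

  substF-agree : (∀ m → P m → σ m ≡ τ m) → ∀ A → AllVarF P A → substF σ A ≡ substF τ A
  substF-agree σ≈τ (atom R ts) p       = cong (atom R) (substTs-agree σ≈τ ts p)
  substF-agree σ≈τ ⊥̇           _       = refl
  substF-agree σ≈τ (A ⇒̇ B)     (p , q) = cong₂ _⇒̇_ (substF-agree σ≈τ A p) (substF-agree σ≈τ B q)
  substF-agree {P} {σ} {τ} σ≈τ (∀̇ A) p = cong ∀̇ (substF-agree up-agree A p)
    where
      up-agree : ∀ m → liftP P m → up σ m ≡ up τ m
      up-agree zero    _ = refl
      up-agree (suc m) q = cong shiftT (σ≈τ m q)

  substF-cong : (∀ m → σ m ≡ τ m) → ∀ A → substF σ A ≡ substF τ A
  substF-cong σ≈τ A = substF-agree (λ m _ → σ≈τ m) A (AllVarF-universal {P = λ _ → ⊤} (λ _ → tt) A)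

  _∘ˢ_ : Subst → Subst → Subst
  (σ ∘ˢ τ) n = substT σ (τ n)

  mutual
    substT-∘ˢ : ∀ σ τ t → substT σ (substT τ t) ≡ substT (σ ∘ˢ τ) t
    substT-∘ˢ σ τ (var n)    = refl
    substT-∘ˢ σ τ (fun f ts) = cong (fun f) (substTs-∘ˢ σ τ ts)

    substTs-∘ˢ : ∀ σ τ (ts : Vec Term k) → substTs σ (substTs τ ts) ≡ substTs (σ ∘ˢ τ) ts
    substTs-∘ˢ σ τ []       = refl
    substTs-∘ˢ σ τ (t ∷ ts) = cong₂ _∷_ (substT-∘ˢ σ τ t) (substTs-∘ˢ σ τ ts)

  up-∘ˢ : ∀ σ τ n → (up σ ∘ˢ up τ) n ≡ up (σ ∘ˢ τ) n
  up-∘ˢ σ τ zero    = refl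
  up-∘ˢ σ τ (suc n) = trans (substT-∘ˢ (up σ) _ (τ n)) (sym (substT-∘ˢ _ σ (τ n)))

  substF-∘ˢ : ∀ σ τ A → substF σ (substF τ A) ≡ substF (σ ∘ˢ τ) A
  substF-∘ˢ σ τ (atom R ts) = cong (atom R) (substTs-∘ˢ σ τ ts)
  substF-∘ˢ σ τ ⊥̇           = refl
  substF-∘ˢ σ τ (A ⇒̇ B)     = cong₂ _⇒̇_ (substF-∘ˢ σ τ A) (substF-∘ˢ σ τ B)
  substF-∘ˢ σ τ (∀̇ A)       = cong ∀̇ (trans (substF-∘ˢ (up σ) (up τ) A) (substF-cong (up-∘ˢ σ τ) A))

  mutual
    substT-var : ∀ t → substT var t ≡ t
    substT-var (var n)    = refl
    substT-var (fun f ts) = cong (fun f) (substTs-var ts)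

    substTs-var : (ts : Vec Term k) → substTs var ts ≡ ts
    substTs-var []       = refl
    substTs-var (t ∷ ts) = cong₂ _∷_ (substT-var t) (substTs-var ts)

  substF-var : ∀ A → substF var A ≡ A
  substF-var (atom R ts) = cong (atom R) (substTs-var ts)
  substF-var ⊥̇           = refl
  substF-var (A ⇒̇ B)     = cong₂ _⇒̇_ (substF-var A) (substF-var B)
  substF-var (∀̇ A)       = cong ∀̇ (trans (substF-cong up-var A) (substF-var A))
    where
      up-var : ∀ n → up var n ≡ var n
      up-var zero    = refl
      up-var (suc n) = refl

  shiftF-up : ∀ σ A → substF (up σ) (shiftF A) ≡ shiftF (substF σ A)
  shiftF-up σ A = trans (substF-∘ˢ (up σ) _ A) (sym (substF-∘ˢ _ σ A))

  inst-shiftT : ∀ t u → substT (inst t) (shiftT u) ≡ u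
  inst-shiftT t u = trans (substT-∘ˢ (inst t) _ u) (substT-var u)

  inst-up : ∀ σ A t → substF (up σ) A [ substT σ t ] ≡ substF σ (A [ t ])
  inst-up σ A t = begin
    substF (up σ) A [ substT σ t ]       ≡⟨ substF-∘ˢ _ (up σ) A ⟩
    substF (inst (substT σ t) ∘ˢ up σ) A ≡⟨ substF-cong pointwise A ⟩
    substF (σ ∘ˢ inst t) A               ≡⟨ substF-∘ˢ σ (inst t) A ⟨
    substF σ (A [ t ])                   ∎
    where
      open ≡-Reasoning
      pointwise : ∀ n → (inst (substT σ t) ∘ˢ up σ) n ≡ (σ ∘ˢ inst t) n
      pointwise zero    = refl
      pointwise (suc n) = inst-shiftT (substT σ t) (σ n)

  -- Derivations

  weaken : Γ ⊆ Δ → Γ ⊢ A → Δ ⊢ A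
  weaken Γ⊆Δ (ctx A∈Γ) = ctx (Γ⊆Δ A∈Γ)
  weaken Γ⊆Δ (⇒I d)    = ⇒I (weaken (⊆.∷⁺ʳ _ Γ⊆Δ) d)
  weaken Γ⊆Δ (⇒E d e)  = ⇒E (weaken Γ⊆Δ d) (weaken Γ⊆Δ e)
  weaken Γ⊆Δ (∀I d)    = ∀I (weaken (⊆.map⁺ shiftF Γ⊆Δ) d)
  weaken Γ⊆Δ (∀E d t)  = ∀E (weaken Γ⊆Δ d) t
  weaken Γ⊆Δ (⊥E d)    = ⊥E (weaken Γ⊆Δ d)
  weaken Γ⊆Δ (DNE d)   = DNE (weaken Γ⊆Δ d)

  ⊢-substF : ∀ σ → Γ ⊢ A → map (substF σ) Γ ⊢ substF σ A
  ⊢-substF σ (ctx A∈Γ) = ctx (∈-map⁺ (substF σ) A∈Γ)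
  ⊢-substF σ (⇒I d)    = ⇒I (⊢-substF σ d)
  ⊢-substF σ (⇒E d e)  = ⇒E (⊢-substF σ d) (⊢-substF σ e)
  ⊢-substF {Γ} σ (∀I {A = A} d) = ∀I (subst (_⊢ substF (up σ) A) shifted-context (⊢-substF (up σ) d))
    where
      shifted-context : map (substF (up σ)) (map shiftF Γ) ≡ map shiftF (map (substF σ) Γ)
      shifted-context = trans (sym (map-∘ Γ)) (trans (map-cong (shiftF-up σ) Γ) (map-∘ Γ))
  ⊢-substF σ (∀E {A = A} d t) = subst (_ ⊢_) (inst-up σ A t) (∀E (⊢-substF σ d) (substT σ t))
  ⊢-substF σ (⊥E d)    = ⊥E (⊢-substF σ d)
  ⊢-substF σ (DNE d)   = DNE (⊢-substF σ d)

  ¬⇒-elimˡ : Γ ⊢ ¬̇ (A ⇒̇ B) → Γ ⊢ A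
  ¬⇒-elimˡ ¬A⇒B = DNE (⇒I (⇒E (weaken there ¬A⇒B) (⇒I (⊥E (⇒E (ctx (there (here refl))) (ctx (here refl)))))))

  ¬⇒-elimʳ : Γ ⊢ ¬̇ (A ⇒̇ B) → Γ ⊢ ¬̇ B
  ¬⇒-elimʳ ¬A⇒B = ⇒I (⇒E (weaken there ¬A⇒B) (⇒I (ctx (there (here refl)))))

  bindVar : ℕ → Subst
  bindVar x m with m ≟ x
  ... | yes _ = var zero
  ... | no _  = var (suc m)

  bindVar-self : ∀ x → bindVar x x ≡ var zero
  bindVar-self x with x ≟ x
  ... | yes _   = refl
  ... | no x≢x  = contradiction refl x≢x

  bindVar-other : ∀ {x m} → m ≢ x → bindVar x m ≡ var (suc m)
  bindVar-other {x} {m} m≢x with m ≟ x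
  ... | yes m≡x = contradiction m≡x m≢x
  ... | no _    = refl

  generalise : ∀ {x} → All (AllVarF (_≢ x)) Γ → AllVarF (_≢ x) (∀̇ C) → Γ ⊢ C [ var x ] → Γ ⊢ ∀̇ C
  generalise {Γ} {C} {x} Γ-fresh C-fresh d =
    ∀I (subst₂ _⊢_ context-shifted body-restored (⊢-substF (bindVar x) d))
    where
      open ≡-Reasoning
      context-shifted : map (substF (bindVar x)) Γ ≡ map shiftF Γ
      context-shifted = map-cong-local (All.map (λ {B} → substF-agree (λ m → bindVar-other) B) Γ-fresh)
      restores : ∀ m → liftP (_≢ x) m → (bindVar x ∘ˢ inst (var x)) m ≡ var m
      restores zero    _   = bindVar-self x
      restores (suc m) m≢x = bindVar-other m≢x
      body-restored : substF (bindVar x) (C [ var x ]) ≡ C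
      body-restored = begin
        substF (bindVar x) (C [ var x ])    ≡⟨ substF-∘ˢ (bindVar x) _ C ⟩
        substF (bindVar x ∘ˢ inst (var x)) C ≡⟨ substF-agree restores C C-fresh ⟩
        substF var C                        ≡⟨ substF-var C ⟩
        C                                   ∎

  _∪_ : Theory → Theory → Theory
  (X ∪ Y) B = X B ⊎ Y B

  _∪｛_｝ : Theory → Form → Theory
  X ∪｛ A ｝ = X ∪ (_≡ A)

  image : (Form → Form) → Theory → Theory
  image f X B = ∃ λ C → X C × B ≡ f C

  ⋃ : (ℕ → Theory) → Theory
  ⋃ Xₙ B = ∃ λ n → Xₙ n B

  Subsingleton : Theory → Set
  Subsingleton Y = ∀ {A B} → Y A → Y B → A ≡ B

  ⊢T-member : X A → X ⊢T A
  ⊢T-member A∈X = _ ∷ [] , A∈X ∷ [] , ctx (here refl)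

  ⊢T-closed : [] ⊢ A → X ⊢T A
  ⊢T-closed d = [] , [] , d

  ⊢T-mono : (∀ {B} → X B → Y B) → X ⊢T A → Y ⊢T A
  ⊢T-mono X⊆Y (Γ , Γ⊆X , d) = Γ , All.map X⊆Y Γ⊆X , d

  ⊢T-map : (∀ {Γ} → Γ ⊢ A → Γ ⊢ B) → X ⊢T A → X ⊢T B
  ⊢T-map rule (Γ , Γ⊆X , d) = Γ , Γ⊆X , rule d

  ⊢T-⇒E : X ⊢T (A ⇒̇ B) → X ⊢T A → X ⊢T B
  ⊢T-⇒E (Γ , Γ⊆X , d) (Δ , Δ⊆X , e) =
    Γ ++ Δ , All.++⁺ Γ⊆X Δ⊆X , ⇒E (weaken (⊆.xs⊆xs++ys Γ Δ) d) (weaken (⊆.xs⊆ys++xs Δ Γ) e)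

  ⊢T-substF : ∀ σ → X ⊢T A → image (substF σ) X ⊢T substF σ A
  ⊢T-substF σ (Γ , Γ⊆X , d) = map (substF σ) Γ , All.map⁺ (All.map (λ B∈X → _ , B∈X , refl) Γ⊆X) , ⊢-substF σ d

  ⊢T-generalise : ∀ {x} → (∀ {B} → X B → AllVarF (_≢ x) B) → AllVarF (_≢ x) (∀̇ C) → X ⊢T (C [ var x ]) → X ⊢T ∀̇ C
  ⊢T-generalise X-fresh C-fresh (Γ , Γ⊆X , d) = Γ , Γ⊆X , generalise (All.map X-fresh Γ⊆X) C-fresh d

  henkinAxiom-irrefutable : ∀ {x} → (∀ {B} → X B → AllVarF (_≢ x) B) → AllVarF (_≢ x) (∀̇ C)
                          → X ⊢T (¬̇ (C [ var x ] ⇒̇ ∀̇ C)) → X ⊢T ⊥̇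
  henkinAxiom-irrefutable X-fresh C-fresh ¬H =
    ⊢T-⇒E (⊢T-map ¬⇒-elimʳ ¬H) (⊢T-generalise X-fresh C-fresh (⊢T-map ¬⇒-elimˡ ¬H))

  separate : Subsingleton Y → All (X ∪ Y) Γ → ∃ λ Γ₀ → All X Γ₀ × (Γ ⊆ Γ₀ ⊎ ∃ λ B → Y B × Γ ⊆ B ∷ Γ₀)
  separate Y-unique [] = [] , [] , inj₁ (λ ())
  separate Y-unique (inj₁ A∈X ∷ Γ⊆X∪Y) with separate Y-unique Γ⊆X∪Y
  ... | Γ₀ , Γ₀⊆X , inj₁ Γ⊆Γ₀           = _ ∷ Γ₀ , A∈X ∷ Γ₀⊆X , inj₁ (⊆.∷⁺ʳ _ Γ⊆Γ₀)
  ... | Γ₀ , Γ₀⊆X , inj₂ (B , B∈Y , Γ⊆) =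
    _ ∷ Γ₀ , A∈X ∷ Γ₀⊆X , inj₂ (B , B∈Y , ⊆.∈-∷⁺ʳ (there (here refl)) (⊆.⊆-trans Γ⊆ (⊆.∷⁺ʳ B (⊆.xs⊆x∷xs Γ₀ _))))
  separate Y-unique (inj₂ A∈Y ∷ Γ⊆X∪Y) with separate Y-unique Γ⊆X∪Y
  ... | Γ₀ , Γ₀⊆X , inj₁ Γ⊆Γ₀           = Γ₀ , Γ₀⊆X , inj₂ (_ , A∈Y , ⊆.∷⁺ʳ _ Γ⊆Γ₀)
  ... | Γ₀ , Γ₀⊆X , inj₂ (B , B∈Y , Γ⊆) = Γ₀ , Γ₀⊆X , inj₂ (B , B∈Y , ⊆.∈-∷⁺ʳ (here (Y-unique A∈Y B∈Y)) Γ⊆)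

  ⊢T-∪-subsingleton : Subsingleton Y → (X ∪ Y) ⊢T A → X ⊢T A ⊎ ∃ λ B → Y B × X ⊢T (B ⇒̇ A)
  ⊢T-∪-subsingleton Y-unique (Γ , Γ⊆X∪Y , d) with separate Y-unique Γ⊆X∪Y
  ... | Γ₀ , Γ₀⊆X , inj₁ Γ⊆Γ₀           = inj₁ (Γ₀ , Γ₀⊆X , weaken Γ⊆Γ₀ d)
  ... | Γ₀ , Γ₀⊆X , inj₂ (B , B∈Y , Γ⊆) = inj₂ (B , B∈Y , Γ₀ , Γ₀⊆X , ⇒I (weaken Γ⊆ d))

  ⊢T-by-contradiction : (X ∪｛ ¬̇ A ｝) ⊢T ⊥̇ → X ⊢T A
  ⊢T-by-contradiction d with ⊢T-∪-subsingleton (λ p q → trans p (sym q)) d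
  ... | inj₁ X⊢⊥                 = ⊢T-map ⊥E X⊢⊥
  ... | inj₂ (_ , refl , X⊢¬¬A) = ⊢T-map DNE X⊢¬¬A

  module _ {Xₙ : ℕ → Theory} (increasing : ∀ {n B} → Xₙ n B → Xₙ (suc n) B) where

    chain-mono : m ≤′ n → Xₙ m B → Xₙ n B
    chain-mono ≤′-refl        B∈Xₘ = B∈Xₘ
    chain-mono (≤′-step m≤′n) B∈Xₘ = increasing (chain-mono m≤′n B∈Xₘ)

    All-⋃ : All (⋃ Xₙ) Γ → ∃ λ n → All (Xₙ n) Γ
    All-⋃ []                  = 0 , []
    All-⋃ ((m , B∈Xₘ) ∷ Γ⊆⋃) with All-⋃ Γ⊆⋃
    ... | n , Γ⊆Xₙ = m ⊔ n , chain-mono (≤⇒≤′ (m≤m⊔n m n)) B∈Xₘ ∷ All.map (chain-mono (≤⇒≤′ (m≤n⊔m m n))) Γ⊆Xₙ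

    ⊢T-⋃ : ⋃ Xₙ ⊢T A → ∃ λ n → Xₙ n ⊢T A
    ⊢T-⋃ (Γ , Γ⊆⋃ , d) with All-⋃ Γ⊆⋃
    ... | n , Γ⊆Xₙ = n , Γ , Γ⊆Xₙ , d

  -- Coding formulae by numbers

  mutual
    codeT : Term → ℕ
    codeT (var n)    = pair 0 n
    codeT (fun f ts) = pair (suc f) (codeTs ts)

    codeTs : Vec Term k → ℕ
    codeTs []       = 0
    codeTs (t ∷ ts) = suc (pair (codeT t) (codeTs ts))

  tag : Form → ℕ
  tag (atom R ts) = 0
  tag ⊥̇           = 1
  tag (A ⇒̇ B)     = 2
  tag (∀̇ A)       = 3

  mutual
    codeF : Form → ℕ
    codeF A = pair (tag A) (payload A)

    payload : Form → ℕ
    payload (atom R ts) = pair R (codeTs ts)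
    payload ⊥̇           = 0
    payload (A ⇒̇ B)     = pair (codeF A) (codeF B)
    payload (∀̇ A)       = codeF A

  mutual
    codeT-injective : ∀ t u → codeT t ≡ codeT u → t ≡ u
    codeT-injective (var n) (var m) eq = cong var (proj₂ (pair-injective eq))
    codeT-injective (var n) (fun g us) eq with () ← proj₁ (pair-injective eq)
    codeT-injective (fun f ts) (var m) eq with () ← proj₁ (pair-injective eq)
    codeT-injective (fun f ts) (fun g us) eq with pair-injective eq
    ... | refl , eq′ = cong (fun f) (codeTs-injective ts us eq′)

    codeTs-injective : (ts us : Vec Term k) → codeTs ts ≡ codeTs us → ts ≡ us
    codeTs-injective []       []       _  = refl
    codeTs-injective (t ∷ ts) (u ∷ us) eq with pair-injective (suc-injective eq)
    ... | eq₁ , eq₂ = cong₂ _∷_ (codeT-injective t u eq₁) (codeTs-injective ts us eq₂)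

  mutual
    codeF-injective : ∀ A B → codeF A ≡ codeF B → A ≡ B
    codeF-injective A B eq = payload-injective A B (proj₁ (pair-injective eq)) (proj₂ (pair-injective eq))

    payload-injective : ∀ A B → tag A ≡ tag B → payload A ≡ payload B → A ≡ B
    payload-injective (atom R ts) (atom R′ us) _ eq with pair-injective eq
    ... | refl , eq′ = cong (atom R) (codeTs-injective ts us eq′)
    payload-injective ⊥̇ ⊥̇ _ _ = refl
    payload-injective (A ⇒̇ B) (A′ ⇒̇ B′) _ eq with pair-injective eq
    ... | eq₁ , eq₂ = cong₂ _⇒̇_ (codeF-injective A A′ eq₁) (codeF-injective B B′ eq₂)
    payload-injective (∀̇ A) (∀̇ A′) _ eq = cong ∀̇ (codeF-injective A A′ eq)
    payload-injective (atom _ _) ⊥̇        () _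
    payload-injective (atom _ _) (_ ⇒̇ _)  () _
    payload-injective (atom _ _) (∀̇ _)    () _
    payload-injective ⊥̇        (atom _ _) () _
    payload-injective ⊥̇        (_ ⇒̇ _)  () _
    payload-injective ⊥̇        (∀̇ _)    () _
    payload-injective (_ ⇒̇ _)  (atom _ _) () _
    payload-injective (_ ⇒̇ _)  ⊥̇        () _
    payload-injective (_ ⇒̇ _)  (∀̇ _)    () _
    payload-injective (∀̇ _)    (atom _ _) () _
    payload-injective (∀̇ _)    ⊥̇        () _
    payload-injective (∀̇ _)    (_ ⇒̇ _)  () _

  bound-mono : ∀ {c d} → c ≤ d → ∀ m → m ≤ c → m ≤ d
  bound-mono c≤d m m≤c = ≤-trans m≤c c≤d

  mutual
    codeT-bound : ∀ t → AllVarT (_≤ codeT t) t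
    codeT-bound (var n)    = ≤-pairʳ 0 n
    codeT-bound (fun f ts) = AllVarTs-mono (bound-mono (≤-pairʳ (suc f) (codeTs ts))) ts (codeTs-bound ts)

    codeTs-bound : (ts : Vec Term k) → AllVarTs (_≤ codeTs ts) ts
    codeTs-bound []       = tt
    codeTs-bound (t ∷ ts) =
      AllVarT-mono (bound-mono (m≤n⇒m≤1+n (≤-pairˡ (codeT t) (codeTs ts)))) t (codeT-bound t) ,
      AllVarTs-mono (bound-mono (m≤n⇒m≤1+n (≤-pairʳ (codeT t) (codeTs ts)))) ts (codeTs-bound ts)

  codeF-bound : ∀ A → AllVarF (_≤ codeF A) A
  codeF-bound (atom R ts) =
    AllVarTs-mono (bound-mono (≤-trans (≤-pairʳ R (codeTs ts)) (≤-pairʳ 0 _))) ts (codeTs-bound ts)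
  codeF-bound ⊥̇           = tt
  codeF-bound (A ⇒̇ B)     =
    AllVarF-mono (bound-mono (≤-trans (≤-pairˡ (codeF A) (codeF B)) (≤-pairʳ 2 _))) A (codeF-bound A) ,
    AllVarF-mono (bound-mono (≤-trans (≤-pairʳ (codeF A) (codeF B)) (≤-pairʳ 2 _))) B (codeF-bound B)
  codeF-bound (∀̇ A)       = AllVarF-mono under-binder A (codeF-bound A)
    where
      under-binder : ∀ m → m ≤ codeF A → liftP (_≤ codeF (∀̇ A)) m
      under-binder zero    _   = tt
      under-binder (suc m) m<c = ≤-trans (n≤1+n m) (≤-trans m<c (≤-pairʳ 3 (codeF A)))

  -- The term model

  termModel : Theory → Model
  termModel X = record
    { D     = Term
    ; funI  = fun
    ; predI = λ R ts → X ⊢T atom R ts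
    ; A⊥    = X ⊢T ⊥̇
    }

  record Saturated (X : Theory) : Set where
    field
      maximal : ∀ B → (X ⊢T (¬̇ B) → X ⊢T ⊥̇) → X ⊢T B
      henkin  : ∀ C → ∃ λ x → X ⊢T (C [ var x ]) → X ⊢T ∀̇ C

  module TermModel (X : Theory) where
    M : Model
    M = termModel X

    mutual
      evalT-substT : ∀ ρ t → evalT M ρ t ≡ substT ρ t
      evalT-substT ρ (var n)    = refl
      evalT-substT ρ (fun f ts) = cong (fun f) (evalTs-substTs ρ ts)

      evalTs-substTs : ∀ ρ (ts : Vec Term k) → evalTs M ρ ts ≡ substTs ρ ts
      evalTs-substTs ρ []       = refl
      evalTs-substTs ρ (t ∷ ts) = cong₂ _∷_ (evalT-substT ρ t) (evalTs-substTs ρ ts)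

    ∷ₐ-inst-up : ∀ ρ B t → substF (_∷ₐ_ M t ρ) B ≡ substF (up ρ) B [ t ]
    ∷ₐ-inst-up ρ B t = trans (substF-cong pointwise B) (sym (substF-∘ˢ (inst t) (up ρ) B))
      where
        pointwise : ∀ n → _∷ₐ_ M t ρ n ≡ (inst t ∘ˢ up ρ) n
        pointwise zero    = refl
        pointwise (suc n) = sym (inst-shiftT t (ρ n))

    module Truth (X-saturated : Saturated X) where
      open Saturated X-saturated

      mutual
        sat⇒⊢ : ∀ B ρ → sat M ρ B → X ⊢T substF ρ B
        sat⇒⊢ (atom R ts) ρ ⊢R = subst (λ us → X ⊢T atom R us) (evalTs-substTs ρ ts) ⊢R
        sat⇒⊢ ⊥̇           ρ ⊢⊥ = ⊢⊥
        sat⇒⊢ (A ⇒̇ B)     ρ f  = maximal _ λ ¬A⇒B →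
          ⊢T-⇒E (⊢T-map ¬⇒-elimʳ ¬A⇒B) (sat⇒⊢ B ρ (f (⊢⇒sat A ρ (⊢T-map ¬⇒-elimˡ ¬A⇒B))))
        sat⇒⊢ (∀̇ B)       ρ f  with henkin (substF (up ρ) B)
        ... | x , witness = witness (subst (X ⊢T_) (∷ₐ-inst-up ρ B (var x)) (sat⇒⊢ B _ (f (var x))))

        ⊢⇒sat : ∀ B ρ → X ⊢T substF ρ B → sat M ρ B
        ⊢⇒sat (atom R ts) ρ ⊢R  = subst (λ us → X ⊢T atom R us) (sym (evalTs-substTs ρ ts)) ⊢R
        ⊢⇒sat ⊥̇           ρ ⊢⊥  = ⊢⊥
        ⊢⇒sat (A ⇒̇ B)     ρ ⊢⇒ a = ⊢⇒sat B ρ (⊢T-⇒E ⊢⇒ (sat⇒⊢ A ρ a))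
        ⊢⇒sat (∀̇ B)       ρ ⊢∀ t =
          ⊢⇒sat B _ (subst (X ⊢T_) (sym (∷ₐ-inst-up ρ B t)) (⊢T-map (λ d → ∀E d t) ⊢∀))

  module HenkinExtension (U : Theory) where
    Ω : Set
    Ω = U ⊢T ⊥̇

    -- U is moved onto the even variables, so that the odd variable henkinVar n is still
    -- fresh when the Henkin axiom of the formula coded n is added.
    evens halves : Subst
    evens  m = var (2 * m)
    halves m = var ⌊ m /2⌋

    henkinVar : ℕ → ℕ
    henkinVar n = suc (2 * n)

    HenkinAxiom : ℕ → Theory
    HenkinAxiom n H = ∃ λ C → codeF C ≡ n × H ≡ (C [ var (henkinVar n) ] ⇒̇ ∀̇ C)

    Admitted : ℕ → Theory → Theory
    Admitted n X B = codeF B ≡ n × (X ⊢T (¬̇ B) → Ω)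

    stage : ℕ → Theory
    stage zero    = image (substF evens) U
    stage (suc n) = X′ ∪ Admitted n X′
      where X′ = stage n ∪ HenkinAxiom n

    Uω : Theory
    Uω = ⋃ stage

    HenkinAxiom-unique : Subsingleton (HenkinAxiom n)
    HenkinAxiom-unique (C , refl , refl) (D , codeD , refl) =
      cong (λ E → E [ var (henkinVar (codeF C)) ] ⇒̇ ∀̇ E) (codeF-injective C D (sym codeD))

    Admitted-unique : Subsingleton (Admitted n X)
    Admitted-unique {A = A} {B} (codeA , _) (codeB , _) = codeF-injective A B (trans codeA (sym codeB))

    Allowed : ℕ → ℕ → Set
    Allowed n m = (∃ λ k → m ≡ 2 * k) ⊎ m < 2 * n

    Allowed-suc : ∀ m → Allowed n m → Allowed (suc n) m
    Allowed-suc     m (inj₁ even)  = inj₁ even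
    Allowed-suc {n} m (inj₂ m<2n) = inj₂ (<-≤-trans m<2n (*-monoʳ-≤ 2 (n≤1+n n)))

    ≤⇒Allowed-suc : ∀ m → m ≤ n → Allowed (suc n) m
    ≤⇒Allowed-suc {n} m m≤n = inj₂ (<-≤-trans (s≤s m≤n) (m≤n*m (suc n) 2))

    Allowed-fresh : ∀ m → Allowed n m → m ≢ henkinVar n
    Allowed-fresh {n} m (inj₁ (k , refl)) = even≢odd k n
    Allowed-fresh     m (inj₂ m<2n)        = <⇒≢ (m<n⇒m<1+n m<2n)

    stage-vars : ∀ n {B} → stage n B → AllVarF (Allowed n) B
    stage-vars zero    (C , _ , refl) =
      AllVarF-substF evens (λ m _ → inj₁ (m , refl)) C (AllVarF-universal {P = λ _ → ⊤} (λ _ → tt) C)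
    stage-vars (suc n) {B} (inj₁ (inj₁ B∈stage)) = AllVarF-mono Allowed-suc B (stage-vars n B∈stage)
    stage-vars (suc n) (inj₁ (inj₂ (C , refl , refl))) =
      AllVarF-substF (inst (var (henkinVar n))) instance-vars C (codeF-bound C) ,
      AllVarF-mono bound-vars C (codeF-bound C)
      where
        instance-vars : ∀ m → m ≤ n → AllVarT (Allowed (suc n)) (inst (var (henkinVar n)) m)
        instance-vars zero    _     = inj₂ (≤-reflexive (sym (*-suc 2 n)))
        instance-vars (suc m) 1+m≤n = ≤⇒Allowed-suc m (<⇒≤ 1+m≤n)
        bound-vars : ∀ m → m ≤ n → liftP (Allowed (suc n)) m
        bound-vars zero    _     = tt
        bound-vars (suc m) 1+m≤n = ≤⇒Allowed-suc m (<⇒≤ 1+m≤n)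
    stage-vars (suc n) {B} (inj₂ (refl , _)) = AllVarF-mono ≤⇒Allowed-suc B (codeF-bound B)

    stage-fresh : ∀ n {B} → stage n B → AllVarF (_≢ henkinVar n) B
    stage-fresh n {B} B∈stage = AllVarF-mono (Allowed-fresh {n}) B (stage-vars n B∈stage)

    henkinVar-fresh : ∀ C → AllVarF (_≢ henkinVar (codeF C)) (∀̇ C)
    henkinVar-fresh C = AllVarF-mono below C (codeF-bound C)
      where
        below : ∀ m → m ≤ codeF C → liftP (_≢ henkinVar (codeF C)) m
        below zero    _     = tt
        below (suc m) 1+m≤c = <⇒≢ (s≤s (≤-trans (n≤1+n m) (≤-trans 1+m≤c (m≤n*m (codeF C) 2))))

    halves-evens : ∀ A → substF halves (substF evens A) ≡ A
    halves-evens A = trans (substF-∘ˢ halves evens A) (trans (substF-cong halve A) (substF-var A))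
      where
        halve : ∀ m → (halves ∘ˢ evens) m ≡ var m
        halve m = cong var (sym (trans (n≡⌊n+n/2⌋ m) (cong (λ k → ⌊ m + k /2⌋) (sym (+-identityʳ m)))))

    stage-consistent : ∀ n → stage n ⊢T ⊥̇ → Ω
    stage-consistent zero d = ⊢T-mono unshift (⊢T-substF halves d)
      where
        unshift : image (substF halves) (image (substF evens) U) B → U B
        unshift (_ , (C , C∈U , refl) , refl) = subst U (sym (halves-evens C)) C∈U
    stage-consistent (suc n) d with ⊢T-∪-subsingleton Admitted-unique d
    ... | inj₂ (_ , (_ , refutes-U) , ¬B) = refutes-U ¬B
    ... | inj₁ d′ with ⊢T-∪-subsingleton HenkinAxiom-unique d′
    ...   | inj₁ d″ = stage-consistent n d″
    ...   | inj₂ (_ , (C , refl , refl) , ¬H) =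
      stage-consistent n (henkinAxiom-irrefutable (stage-fresh n) (henkinVar-fresh C) ¬H)

    Uω-consistent : Uω ⊢T ⊥̇ → Ω
    Uω-consistent d with ⊢T-⋃ (λ B∈stage → inj₁ (inj₁ B∈stage)) d
    ... | n , d′ = stage-consistent n d′

    Uω-maximal : ∀ B → (Uω ⊢T (¬̇ B) → Uω ⊢T ⊥̇) → Uω ⊢T B
    Uω-maximal B refute-B⇒refute-Uω = ⊢T-member (suc (codeF B) , inj₂ (refl , B-admitted))
      where
        B-admitted : (stage (codeF B) ∪ HenkinAxiom (codeF B)) ⊢T (¬̇ B) → Ω
        B-admitted = Uω-consistent ∘ refute-B⇒refute-Uω ∘ ⊢T-mono (λ D∈ → suc (codeF B) , inj₁ D∈)

    Uω-henkin : ∀ C → ∃ λ x → Uω ⊢T (C [ var x ]) → Uω ⊢T ∀̇ C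
    Uω-henkin C = henkinVar (codeF C) , ⊢T-⇒E (⊢T-member (suc (codeF C) , inj₁ (inj₂ (C , refl , refl))))

    Uω-saturated : Saturated Uω
    Uω-saturated = record { maximal = Uω-maximal ; henkin = Uω-henkin }

    open TermModel Uω public using (M)
    open TermModel.Truth Uω Uω-saturated

    M-satisfies-U : U B → sat M evens B
    M-satisfies-U {B} B∈U = ⊢⇒sat B evens (⊢T-member (0 , B , B∈U , refl))

    M-classic : ∀ B → sat M evens (¬̇ (¬̇ B) ⇒̇ B)
    M-classic B = ⊢⇒sat (¬̇ (¬̇ B) ⇒̇ B) evens (⊢T-closed (⇒I (DNE (ctx (here refl)))))

  completeness : (T : Theory) (A : Form) → T ⊨ᵉ A → T ⊢T A
  completeness T A T⊨A = ⊢T-by-contradiction (Uω-consistent (M-satisfies-U (inj₂ refl) M⊨A))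
    where
      open HenkinExtension (T ∪｛ ¬̇ A ｝)
      M⊨A : sat M evens A
      M⊨A = T⊨A M evens M-classic (λ B → M-satisfies-U {B} ∘ inj₁)

mainTheorem2 : (S : Signature) (T : Syntax.Form S → Set) (A : Syntax.Form S)
    → Syntax.Enumerable S T
    → Syntax._⊨ᵉ_ S T A
    → Syntax._⊢T_ S T A
mainTheorem2 S T A _ = Completeness.completeness S T A
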